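{- Let $G=(V,E)$ be a hypergraph with $m$ edges, rank $r$ and size $M$, let $w:V\to\mathbb{R}^+$ be vertex weights, and let $\epsilon>0$. On input $(G,w,\epsilon)$, the algorithm Cover (defined in the context), run on an EREW-PRAM, requires $O\!\left(r\,\ln^2 m\,\ln\frac{1}{\epsilon}\right)$ time and $M/\ln^2 m$ processors, i.e., $O\!\left(r\,M\,\ln\frac{1}{\epsilon}\right)$ operations.
   Context: Hypergraph: a vertex set $V$ and a set $E\subseteq 2^V$ of edges; $E(v)$ is the set of edges incident to (containing) the vertex $v$. The rank $r$ is the maximum size of any edge, and the size $M$ is the sum of the edge sizes. A vertex cover is a set $C\subseteq V$ such that every edge contains some vertex of $C$; its weight is $w(C)=\sum_{v\in C}w(v)$. The algorithm is meant to return a vertex cover of weight at most $r/(1-\epsilon)$ times the minimum. (Equivalently, in set-cover terms: vertices are sets, edges are elements, $m$ is the number of elements, $M$ is the sum of the set sizes, and $r$ is the maximum number of sets in which any element occurs.) Algorithm Cover$(G,w,\epsilon)$. 1. For each $v\in V$ in parallel: $w_p(v)\leftarrow w(v)$; $E_p(v)\leftarrow E(v)$; $d_p(v)\leftarrow |E(v)|$. 2. While edges remain, do one iteration: (a) for each remaining edge $e$ in parallel, $\delta(e)\leftarrow\min_{v\in e} w_p(v)/d_p(v)$; (b) for each remaining vertex $v$ in parallel, $w_p(v)\leftarrow w_p(v)-\sum_{e\in E_p(v)}\delta(e)$, and if then $w_p(v)\le\epsilon\,w(v)$, delete $v$ and its incident edges, updating the sets $E_p(\cdot)$ of remaining incident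 edges and the degrees $d_p(\cdot)=|E_p(\cdot)|$. 3. Return the set of deleted vertices. Cost model: EREW-PRAM. Using standard parallel techniques, each iteration of the while loop beginning with $q$ remaining edges is done in $O(\ln q)$ time and $O(r\,q)$ operations. "Operations" means total work; the number of processors is the work divided by the time (Work-Time Scheduling Principle).
   Formalization: The bounds are stated for m ≥ 2 and 0 < ε ≤ ε₀, for any fixed ε₀ < 1, with the constant depending on ε₀ (for ε ≥ 1 or m = 1 the bounds are ≤ 0 or undefined, and no uniform constant exists as ε → 1); edges are nonempty. -}

module Defs where

open import Algebra.Bundles using (CommutativeRing)
import Algebra.Definitions.RawMonoid as RawMonoidDefinitions
import Algebra.Properties.CommutativeMonoid.Sum as CommutativeMonoidSum
open import Data.Bool.Base using (_∧_; _∨_; not; if_then_else_)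
open import Data.Fin.Base using (Fin)
open import Data.Fin.Subset using (Subset; _∈_; _∩_; ∣_∣; Nonempty; ⊤; ⊥)
open import Data.Fin.Subset.Properties using (_∈?_; nonempty?)
open import Data.List.Base as List using (List)
import Data.List.Extrema as Extrema
open import Data.Nat.Base as ℕ using (ℕ; zero; suc; NonZero)
import Data.Nat.DivMod as ℕ
import Data.Nat.Properties as ℕ
open import Data.Product.Base using (∃; _×_; proj₁)
open import Data.Vec.Base using (lookup; tabulate)
import Data.Vec.Functional as Vector
open import Function.Definitions using (Injective)
open import Level using (0ℓ)
open import Relation.Binary.Bundles using (DecTotalOrder)
open import Relation.Binary.Core using (Rel)
import Relation.Binary.Construct.NonStrictToStrict as NonStrictToStrict
open import Relation.Binary.PropositionalEquality.Core using (_≡_; _≢_)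
open import Relation.Binary.Structures using (IsDecTotalOrder)
open import Relation.Nullary.Decidable.Core using (does)
open import Relation.Nullary.Negation.Core using (¬_)
open import Relation.Unary using (Pred; Satisfiable)

-- The classical real numbers: a Dedekind-complete ordered field with
-- decidable order, together with its natural logarithm.  Classically these
-- axioms determine the structure up to isomorphism (`archimedean` then
-- follows from `supremum`, but not constructively) and determine ln on the
-- positive reals.  The values of _⁻¹ at 0 and of ln outside the positive
-- reals are unspecified.
record Reals : Set₁ where
  field
    commutativeRing : CommutativeRing 0ℓ 0ℓ

  open CommutativeRing commutativeRing public
    renaming (Carrier to ℝ; zero to *-zero)
  open RawMonoidDefinitions +-rawMonoid using () renaming (_×_ to _times_)

  ι : ℕ → ℝ
  ι n = n times 1#

  infix 4 _≤_
  infix 9 _⁻¹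

  field
    _≤_             : Rel ℝ 0ℓ
    isDecTotalOrder : IsDecTotalOrder _≈_ _≤_

  open NonStrictToStrict _≈_ _≤_ public using (_<_)

  UpperBound : Pred ℝ 0ℓ → ℝ → Set
  UpperBound P b = ∀ x → P x → x ≤ b

  field
    0≉1       : ¬ (0# ≈ 1#)
    +-monoʳ-≤ : ∀ z {x y} → x ≤ y → z + x ≤ z + y
    *-nonNeg  : ∀ {x y} → 0# ≤ x → 0# ≤ y → 0# ≤ x * y

    _⁻¹      : ℝ → ℝ
    inverseʳ : ∀ {x} → ¬ (x ≈ 0#) → x * x ⁻¹ ≈ 1#

    archimedean : ∀ x → ∃ λ n → x ≤ ι n
    supremum    : ∀ (P : Pred ℝ 0ℓ) → Satisfiable P → ∃ (UpperBound P) →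
                  ∃ λ s → UpperBound P s × (∀ b → UpperBound P b → s ≤ b)

    ln      : ℝ → ℝ
    ln-cong : ∀ {x y} → x ≈ y → ln x ≈ ln y
    ln-*    : ∀ {x y} → 0# < x → 0# < y → ln (x * y) ≈ ln x + ln y
    ln≤x-1  : ∀ {x} → 0# < x → ln x ≤ x - 1#

  decTotalOrder : DecTotalOrder 0ℓ 0ℓ 0ℓ
  decTotalOrder = record { isDecTotalOrder = isDecTotalOrder }

  open DecTotalOrder decTotalOrder public using (_≤?_; totalOrder)
  open Extrema totalOrder public using (min)
  open CommutativeMonoidSum +-commutativeMonoid public using (sum)

  infixl 7 _/_
  _/_ : ℝ → ℝ → ℝ
  x / y = x * y ⁻¹

  ln² : ℝ → ℝ
  ln² x = ln x * ln x

-- A hypergraph with vertex set Fin n and m (distinct) edges.  An empty edge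
-- would leave the minimum defining δ undefined and admit no vertex cover.
record Hypergraph (n m : ℕ) : Set where
  field
    edge          : Fin m → Subset n
    edge-distinct : Injective _≡_ _≡_ edge
    edge-nonempty : ∀ e → Nonempty (edge e)

  incident : Fin n → Subset m
  incident v = tabulate λ e → lookup (edge e) v

  rank : ℕ
  rank = Vector.foldr ℕ._⊔_ 0 λ e → ∣ edge e ∣

  size : ℕ
  size = Vector.foldr ℕ._+_ 0 λ e → ∣ edge e ∣

members : ∀ {n} → Subset n → List (Fin n)
members {n} p = List.filter (_∈? p) (List.allFin n)

-- A parallel computation in the work-time presentation: the number of
-- operations performed in each successive parallel time step.
Schedule : Set
Schedule = List ℕ

time : Schedule → ℕ
time = List.length

operations : Schedule → ℕ
operations = List.sum

-- Work-time scheduling: p processors simulate a parallel time step of k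
-- operations in ⌈ k / p ⌉ steps.
timeOn : (p : ℕ) .{{_ : NonZero p}} → Schedule → ℕ
timeOn p s = List.sum (List.map (λ k → (k ℕ.+ ℕ.pred p) ℕ./ p) s)

module Cover (𝓡 : Reals) where
  open Reals 𝓡

  record Input : Set where
    field
      {n m} : ℕ
      G     : Hypergraph n m
      w     : Fin n → ℝ
      w>0   : ∀ v → 0# < w v
      ε     : ℝ
      ε>0   : 0# < ε

    open Hypergraph G public

  record State (n m : ℕ) : Set where
    field
      wₚ        : Fin n → ℝ
      deleted   : Subset n
      remaining : Subset m

  module Algorithm (I : Input) where
    open Input I

    initial : State n m
    initial = record { wₚ = w ; deleted = ⊥ ; remaining = ⊤ }

    module Iteration (s : State n m) where
      open State s

      Eₚ : Fin n → Subset m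
      Eₚ v = incident v ∩ remaining

      dₚ : Fin n → ℕ
      dₚ v = ∣ Eₚ v ∣

      -- Only used for remaining e, where dₚ v ≥ 1 for every v in e.  The
      -- first argument of min is the value at one particular vertex of e.
      δ : Fin m → ℝ
      δ e = min (ratio (proj₁ (edge-nonempty e)))
                (List.map ratio (members (edge e)))
        where
        ratio : Fin n → ℝ
        ratio v = wₚ v / ι (dₚ v)

      wₚ′ : Fin n → ℝ
      wₚ′ v =
        if does (v ∈? deleted)
        then wₚ v
        else wₚ v - sum (λ e → if does (e ∈? Eₚ v) then δ e else 0#)

      deleted′ : Subset n
      deleted′ = tabulate λ v →
        does (v ∈? deleted) ∨ does (wₚ′ v ≤? ε * w v)

      remaining′ : Subset m
      remaining′ = tabulate λ e →
        does (e ∈? remaining) ∧ not (does (nonempty? (edge e ∩ deleted′)))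

      next : State n m
      next = record { wₚ = wₚ′ ; deleted = deleted′ ; remaining = remaining′ }

    stateAfter : ℕ → State n m
    stateAfter zero    = initial
    stateAfter (suc k) = Iteration.next (stateAfter k)

    edgesAfter : ℕ → ℕ
    edgesAfter k = ∣ State.remaining (stateAfter k) ∣

    -- The while loop performs exactly T iterations.
    HaltsAfter : ℕ → Set
    HaltsAfter T = edgesAfter T ≡ 0 × (∀ k → k ℕ.< T → edgesAfter k ≢ 0)

    output : ℕ → Subset n
    output T = State.deleted (stateAfter T)

  open Algorithm public using (edgesAfter; HaltsAfter)

  -- The assumed EREW-PRAM cost: an iteration beginning with q remaining edges
  -- takes O(ln q) time and O(r q) operations.  The summand 1 allows for
  -- q = 1, where ln q = 0.
  record Implementation : Set where
    field
      iteration : Input → ℕ → Schedule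
      a b       : ℝ
      iteration-time : ∀ I k → edgesAfter I k ≢ 0 →
        ι (time (iteration I k)) ≤ a * (1# + ln (ι (edgesAfter I k)))
      iteration-operations : ∀ I k → edgesAfter I k ≢ 0 →
        ι (operations (iteration I k)) ≤
          b * (ι (Input.rank I) * ι (edgesAfter I k))

    -- The whole run, when the while loop performs T iterations.
    run : Input → ℕ → Schedule
    run I T = List.concat (List.applyUpTo (iteration I) T)

{-# OPTIONS --safe #-}

-- With K = 1 + ln (1/ε), the potential Φ = Σ_v d(v) (1 + ln (w_p(v) / (ε w(v)))) lies
-- between 0 and r K q when q edges remain, and is at most M K at the start.  An
-- iteration takes Σ_{e ∋ v} δ(e) off w_p(v), which lowers the term of v by at least
-- Σ_{e ∋ v} δ(e) d(v) / w_p(v): if v survives because ln (1 - x) ≤ - x, and if v is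
-- deleted because the term was at least d(v).  Since δ(e) = w_p(v) / d(v) for some
-- v ∈ e, each remaining edge contributes at least 1 to these losses, so Φ falls by at
-- least q.  Summing the falls bounds the total work by r Φ₀ ≤ r M K up to a constant,
-- and the auxiliary potential Φ / q + r K ln q, which falls by at least 1, bounds the
-- number of iterations by r K (1 + ln m).

module Submission where

import Algebra.Properties.Ring as RingProperties
import Algebra.Properties.Semiring.Mult as SemiringMult
import Algebra.Properties.Semiring.Sum as SemiringSum
import Algebra.Solver.Ring.NaturalCoefficients.Default as NaturalCoefficientsSolver
open import Data.Bool.Base using (Bool; true; false; not; _∧_; _∨_; if_then_else_)
open import Data.Bool.Properties using (∨-zeroʳ)
open import Data.Empty using (⊥-elim)
open import Data.Fin.Base using (Fin; zero; suc)
open import Data.Fin.Subset using (Subset; _∈_; _∉_; _⊆_; _∩_; ∣_∣; Empty)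
open import Data.Fin.Subset.Properties
  using (_∈?_; ∉⊥; ∣⊥∣≡0; ∣⊤∣≡n; Empty-unique; nonempty?; x∈p∩q⁺; x∈p∩q⁻;
         p⊆q⇒∣p∣≤∣q∣; x∈p⇒∣p-x∣<∣p∣)
open import Data.List.Base as List using (applyUpTo)
import Data.List.Extrema as Extrema
open import Data.List.Membership.Propositional using () renaming (_∈_ to _∈ₗ_)
import Data.List.Membership.Propositional.Properties as List∈
import Data.List.Properties as List
import Data.List.Relation.Unary.All as All
open import Data.Nat.Base as ℕ using (ℕ; zero; suc; NonZero)
import Data.Nat.DivMod as ℕ
import Data.Nat.ListAction as ListAction
import Data.Nat.ListAction.Properties as ListAction
import Data.Nat.Properties as ℕ
import Data.Nat.Tactic.RingSolver as ℕSolver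
open import Data.Product.Base using (∃; _×_; _,_; proj₁; proj₂)
open import Data.Sum.Base using (_⊎_; inj₁; inj₂)
open import Data.Vec.Base using (lookup; tabulate; []; _∷_)
import Data.Vec.Functional as Vector
open import Data.Vec.Properties using ([]=⇒lookup; lookup⇒[]=; lookup∘tabulate; lookup-zipWith)
open import Function.Base using (_∘_)
open import Relation.Binary.Bundles using (DecTotalOrder)
import Relation.Binary.Construct.NonStrictToStrict as NonStrictToStrict
open import Relation.Binary.PropositionalEquality.Core as ≡ using (_≡_; _≢_)
import Relation.Binary.Reasoning.PartialOrder as PartialOrderReasoning
open import Relation.Nullary.Decidable using (Dec; yes; no; does; dec-true)
open import Relation.Nullary.Negation.Core using (¬_)
open import Defs

-- Ordered-field arithmetic and the embedding of the natural numbers.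

module OrderedField (𝓡 : Reals) where
  open Reals 𝓡
  open DecTotalOrder decTotalOrder public
    using (poset; total)
    renaming (refl to ≤-refl; trans to ≤-trans; reflexive to ≤-reflexive; antisym to ≤-antisym)
  open RingProperties ring using (-‿distribʳ-*)
  open SemiringMult semiring public using (×1-homo-*; ×-homo-+)
  open SemiringSum semiring public using (*-distribˡ-sum; *-distribʳ-sum; ∑-comm; ∑-distrib-+; sum-cong-≋)
  module Solver = NaturalCoefficientsSolver commutativeSemiring
  open Solver using (solve; _:=_; _:+_; _:*_; con)
  module ≤-R = PartialOrderReasoning poset
  open ≤-R

  <⇒≤ : ∀ {x y} → x < y → x ≤ y
  <⇒≤ = proj₁

  ≰⇒> : ∀ {x y} → ¬ (x ≤ y) → y < x
  ≰⇒> = NonStrictToStrict.≰⇒> _≈_ _≤_ sym ≤-reflexive total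

  <⇒≱ : ∀ {x y} → x < y → ¬ (y ≤ x)
  <⇒≱ = NonStrictToStrict.<⇒≱ _≈_ _≤_ ≤-antisym

  <-≤-trans : ∀ {x y z} → x < y → y ≤ z → x < z
  <-≤-trans {x} {y} {z} x<y y≤z = begin-strict x <⟨ x<y ⟩ y ≤⟨ y≤z ⟩ z ∎

  ≤-<-trans : ∀ {x y z} → x ≤ y → y < z → x < z
  ≤-<-trans {x} {y} {z} x≤y y<z = begin-strict x ≤⟨ x≤y ⟩ y <⟨ y<z ⟩ z ∎

  x-y+y≈x : ∀ x y → x - y + y ≈ x
  x-y+y≈x x y = trans (+-assoc x (- y) y) (trans (+-congˡ (-‿inverseˡ y)) (+-identityʳ x))

  +-monoˡ-≤ : ∀ z {x y} → x ≤ y → x + z ≤ y + z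
  +-monoˡ-≤ z {x} {y} x≤y = begin
    x + z ≈⟨ +-comm x z ⟩
    z + x ≤⟨ +-monoʳ-≤ z x≤y ⟩
    z + y ≈⟨ +-comm z y ⟩
    y + z ∎

  +-mono-≤ : ∀ {x y u v} → x ≤ y → u ≤ v → x + u ≤ y + v
  +-mono-≤ {y = y} {u} x≤y u≤v = ≤-trans (+-monoˡ-≤ u x≤y) (+-monoʳ-≤ y u≤v)

  +-cancelʳ-≤ : ∀ z {x y} → x + z ≤ y + z → x ≤ y
  +-cancelʳ-≤ z {x} {y} x+z≤y+z = begin
    x             ≈⟨ x+z-z≈x x ⟨
    x + z + (- z) ≤⟨ +-monoˡ-≤ (- z) x+z≤y+z ⟩
    y + z + (- z) ≈⟨ x+z-z≈x y ⟩
    y             ∎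
    where
    x+z-z≈x : ∀ x → x + z + (- z) ≈ x
    x+z-z≈x x = trans (+-assoc x z (- z)) (trans (+-congˡ (-‿inverseʳ z)) (+-identityʳ x))

  x≤y⇒0≤y-x : ∀ {x y} → x ≤ y → 0# ≤ y - x
  x≤y⇒0≤y-x {x} {y} x≤y = +-cancelʳ-≤ x (begin
    0# + x    ≈⟨ +-identityˡ x ⟩
    x         ≤⟨ x≤y ⟩
    y         ≈⟨ x-y+y≈x y x ⟨
    y - x + x ∎)

  x≤x+y : ∀ {x y} → 0# ≤ y → x ≤ x + y
  x≤x+y {x} {y} 0≤y = begin
    x      ≈⟨ +-identityʳ x ⟨
    x + 0# ≤⟨ +-monoʳ-≤ x 0≤y ⟩
    x + y  ∎

  x≤y+x : ∀ {x y} → 0# ≤ y → x ≤ y + x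
  x≤y+x {x} {y} 0≤y = ≤-trans (x≤x+y 0≤y) (≤-reflexive (+-comm x y))

  +-nonNeg : ∀ {x y} → 0# ≤ x → 0# ≤ y → 0# ≤ x + y
  +-nonNeg 0≤x 0≤y = ≤-trans 0≤x (x≤x+y 0≤y)

  *-monoˡ-≤ : ∀ {z x y} → 0# ≤ z → x ≤ y → z * x ≤ z * y
  *-monoˡ-≤ {z} {x} {y} 0≤z x≤y = begin
    z * x               ≤⟨ x≤y+x (*-nonNeg 0≤z (x≤y⇒0≤y-x x≤y)) ⟩
    z * (y - x) + z * x ≈⟨ distribˡ z (y - x) x ⟨
    z * (y - x + x)     ≈⟨ *-congˡ (x-y+y≈x y x) ⟩
    z * y               ∎

  *-monoʳ-≤ : ∀ {z x y} → 0# ≤ z → x ≤ y → x * z ≤ y * z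
  *-monoʳ-≤ {z} {x} {y} 0≤z x≤y = begin
    x * z ≈⟨ *-comm x z ⟩
    z * x ≤⟨ *-monoˡ-≤ 0≤z x≤y ⟩
    z * y ≈⟨ *-comm z y ⟩
    y * z ∎

  *-mono-≤ : ∀ {x y u v} → 0# ≤ x → 0# ≤ v → x ≤ y → u ≤ v → x * u ≤ y * v
  *-mono-≤ 0≤x 0≤v x≤y u≤v = ≤-trans (*-monoˡ-≤ 0≤x u≤v) (*-monoʳ-≤ 0≤v x≤y)

  -- If 1 ≤ 0 then -1 is nonnegative, and so is its square, which is 1.
  0≤1 : 0# ≤ 1#
  0≤1 with total 0# 1#
  ... | inj₁ 0≤1 = 0≤1
  ... | inj₂ 1≤0 = begin
    0#              ≤⟨ *-nonNeg 0≤-1 0≤-1 ⟩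
    - 1# * - 1#     ≈⟨ -‿distribʳ-* (- 1#) 1# ⟨
    - (- 1# * 1#)   ≈⟨ -‿cong (*-identityʳ (- 1#)) ⟩
    - - 1#          ≈⟨ +-identityˡ (- - 1#) ⟨
    0# - - 1#       ≈⟨ +-congʳ (-‿inverseʳ 1#) ⟨
    1# - 1# - - 1#  ≈⟨ +-assoc 1# (- 1#) (- - 1#) ⟩
    1# + (- 1# - - 1#) ≈⟨ +-congˡ (-‿inverseʳ (- 1#)) ⟩
    1# + 0#         ≈⟨ +-identityʳ 1# ⟩
    1#              ∎
    where
    0≤-1 : 0# ≤ - 1#
    0≤-1 = ≤-trans (x≤y⇒0≤y-x 1≤0) (≤-reflexive (+-identityˡ (- 1#)))

  0<1 : 0# < 1#
  0<1 = 0≤1 , 0≉1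

  0<⇒*⁻¹≈1 : ∀ {x} → 0# < x → x * x ⁻¹ ≈ 1#
  0<⇒*⁻¹≈1 0<x = inverseʳ λ x≈0 → proj₂ 0<x (sym x≈0)

  *-pos : ∀ {x y} → 0# < x → 0# < y → 0# < x * y
  *-pos {x} {y} 0<x 0<y = *-nonNeg (<⇒≤ 0<x) (<⇒≤ 0<y) , λ 0≈xy → proj₂ 0<x (begin-equality
    0#             ≈⟨ zeroˡ (y ⁻¹) ⟨
    0# * y ⁻¹      ≈⟨ *-congʳ 0≈xy ⟩
    x * y * y ⁻¹   ≈⟨ *-assoc x y (y ⁻¹) ⟩
    x * (y * y ⁻¹) ≈⟨ *-congˡ (0<⇒*⁻¹≈1 0<y) ⟩
    x * 1#         ≈⟨ *-identityʳ x ⟩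
    x              ∎)

  ⁻¹-pos : ∀ {x} → 0# < x → 0# < x ⁻¹
  ⁻¹-pos {x} 0<x = ≰⇒> λ x⁻¹≤0 → <⇒≱ 0<1 (begin
    1#       ≈⟨ 0<⇒*⁻¹≈1 0<x ⟨
    x * x ⁻¹ ≤⟨ *-monoˡ-≤ (<⇒≤ 0<x) x⁻¹≤0 ⟩
    x * 0#   ≈⟨ zeroʳ x ⟩
    0#       ∎)

  *-cancelˡ-≤ : ∀ {z x y} → 0# < z → z * x ≤ z * y → x ≤ y
  *-cancelˡ-≤ {z} {x} {y} 0<z zx≤zy = begin
    x              ≈⟨ z⁻¹zx≈x x ⟨
    z ⁻¹ * (z * x) ≤⟨ *-monoˡ-≤ (<⇒≤ (⁻¹-pos 0<z)) zx≤zy ⟩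
    z ⁻¹ * (z * y) ≈⟨ z⁻¹zx≈x y ⟩
    y              ∎
    where
    z⁻¹zx≈x : ∀ x → z ⁻¹ * (z * x) ≈ x
    z⁻¹zx≈x x = begin-equality
      z ⁻¹ * (z * x) ≈⟨ solve 3 (λ i z x → i :* (z :* x) := z :* i :* x) refl (z ⁻¹) z x ⟩
      z * z ⁻¹ * x   ≈⟨ *-congʳ (0<⇒*⁻¹≈1 0<z) ⟩
      1# * x         ≈⟨ *-identityˡ x ⟩
      x              ∎

  x/y*y≈x : ∀ x {y} → 0# < y → x / y * y ≈ x
  x/y*y≈x x {y} 0<y = begin-equality
    x / y * y      ≈⟨ solve 3 (λ i x y → x :* i :* y := x :* (y :* i)) refl (y ⁻¹) x y ⟩
    x * (y * y ⁻¹) ≈⟨ *-congˡ (0<⇒*⁻¹≈1 0<y) ⟩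
    x * 1#         ≈⟨ *-identityʳ x ⟩
    x              ∎

  ι-+ : ∀ m n → ι (m ℕ.+ n) ≈ ι m + ι n
  ι-+ = ×-homo-+ 1#

  ι-* : ∀ m n → ι (m ℕ.* n) ≈ ι m * ι n
  ι-* = ×1-homo-*

  ι-nonNeg : ∀ n → 0# ≤ ι n
  ι-nonNeg zero    = ≤-refl
  ι-nonNeg (suc n) = +-nonNeg 0≤1 (ι-nonNeg n)

  ι-mono : ∀ {m n} → m ℕ.≤ n → ι m ≤ ι n
  ι-mono {n = n} ℕ.z≤n = ι-nonNeg n
  ι-mono (ℕ.s≤s m≤n)   = +-monoʳ-≤ 1# (ι-mono m≤n)

  1≤ι : ∀ {n} → n ≢ 0 → 1# ≤ ι n
  1≤ι {zero}  n≢0 = ⊥-elim (n≢0 ≡.refl)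
  1≤ι {suc n} _   = x≤x+y (ι-nonNeg n)

  ι-pos : ∀ {n} → n ≢ 0 → 0# < ι n
  ι-pos n≢0 = <-≤-trans 0<1 (1≤ι n≢0)

  -- Inequalities for the logarithm.

  ln+1≤ : ∀ {x} → 0# < x → ln x + 1# ≤ x
  ln+1≤ {x} 0<x = ≤-trans (+-monoˡ-≤ 1# (ln≤x-1 0<x)) (≤-reflexive (x-y+y≈x x 1#))

  -- ln (x / y) ≤ x / y − 1, multiplied out so that no subtraction occurs.
  ln-increment : ∀ {x y s} → 0# < x → 0# < y → x + s ≈ y → ln x + s / y ≤ ln y
  ln-increment {x} {y} {s} 0<x 0<y x+s≈y = +-cancelʳ-≤ 1# (begin
    ln x + s / y + 1#           ≈⟨ +-congʳ (+-congʳ ln-x) ⟩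
    ln x/y + ln y + s / y + 1#
      ≈⟨ solve 4 (λ a b c d → a :+ b :+ c :+ d := a :+ d :+ (c :+ b)) refl (ln x/y) (ln y) (s / y) 1# ⟩
    ln x/y + 1# + (s / y + ln y) ≤⟨ +-monoˡ-≤ _ (ln+1≤ (*-pos 0<x (⁻¹-pos 0<y))) ⟩
    x / y + (s / y + ln y)
      ≈⟨ solve 4 (λ x s i l → x :* i :+ (s :* i :+ l) := l :+ (x :+ s) :* i) refl x s (y ⁻¹) (ln y) ⟩
    ln y + (x + s) / y          ≈⟨ +-congˡ (trans (*-congʳ x+s≈y) (0<⇒*⁻¹≈1 0<y)) ⟩
    ln y + 1#                   ∎)
    where
    x/y = x / y
    ln-x : ln x ≈ ln x/y + ln y
    ln-x = trans (ln-cong (sym (x/y*y≈x x 0<y))) (ln-* (*-pos 0<x (⁻¹-pos 0<y)) 0<y)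

  ln-mono : ∀ {x y} → 0# < x → x ≤ y → ln x ≤ ln y
  ln-mono {x} {y} 0<x x≤y = ≤-trans
    (x≤x+y (*-nonNeg (x≤y⇒0≤y-x x≤y) (<⇒≤ (⁻¹-pos 0<y))))
    (ln-increment 0<x 0<y (trans (+-comm x (y - x)) (x-y+y≈x y x)))
    where 0<y = <-≤-trans 0<x x≤y

  x+y≈y⇒x≈0 : ∀ {x y} → x + y ≈ y → x ≈ 0#
  x+y≈y⇒x≈0 {x} {y} eq = ≤-antisym
    (+-cancelʳ-≤ y (≤-reflexive (trans eq (sym (+-identityˡ y)))))
    (+-cancelʳ-≤ y (≤-reflexive (trans (+-identityˡ y) (sym eq))))

  ln-1 : ln 1# ≈ 0#
  ln-1 = x+y≈y⇒x≈0 (trans (sym (ln-* 0<1 0<1)) (ln-cong (*-identityˡ 1#)))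

  1/-pos : ∀ {x} → 0# < x → 0# < 1# / x
  1/-pos 0<x = *-pos 0<1 (⁻¹-pos 0<x)

  ln-1/ : ∀ {x} → 0# < x → ln (1# / x) + ln x ≈ 0#
  ln-1/ {x} 0<x = begin-equality
    ln (1# / x) + ln x ≈⟨ ln-* (1/-pos 0<x) 0<x ⟨
    ln (1# / x * x)    ≈⟨ ln-cong (x/y*y≈x 1# 0<x) ⟩
    ln 1#              ≈⟨ ln-1 ⟩
    0#                 ∎

  -- Since `ln (1# / x)` is the negative of `ln x`, this is `ln x + 1 ≤ x` rearranged. It keeps ln
  -- (1/ε) away from 0 when ε is bounded away from 1.
  1-x≤ln[1/x] : ∀ {x} → 0# < x → 1# - x ≤ ln (1# / x)
  1-x≤ln[1/x] {x} 0<x = +-cancelʳ-≤ x (begin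
    1# - x + x                  ≈⟨ x-y+y≈x 1# x ⟩
    1#                          ≈⟨ +-identityˡ 1# ⟨
    0# + 1#                     ≈⟨ +-congʳ (ln-1/ 0<x) ⟨
    ln (1# / x) + ln x + 1#     ≈⟨ +-assoc _ _ _ ⟩
    ln (1# / x) + (ln x + 1#)   ≤⟨ +-monoʳ-≤ _ (ln+1≤ 0<x) ⟩
    ln (1# / x) + x             ∎)

  0≤ln-ι : ∀ {n} → n ≢ 0 → 0# ≤ ln (ι n)
  0≤ln-ι n≢0 = ≤-trans (≤-reflexive (sym ln-1)) (ln-mono 0<1 (1≤ι n≢0))

  -- Going from 1 to 2, `ln-increment` yields ln 2 ≥ 1/2. This crude bound is enough to absorb the
  -- summand 1 of 1 + ln m into a multiple of ln m.
  1≤2ln-ι : ∀ {n} → 2 ℕ.≤ n → 1# ≤ ln (ι n) + ln (ι n)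
  1≤2ln-ι {n} 2≤n = begin
    1#                                ≈⟨ 0<⇒*⁻¹≈1 0<2 ⟨
    ι 2 / ι 2
      -- `ι 2` unfolds to 1 + (1 + 0), and the zeros on the right-hand side stand for ln 1.
      ≈⟨ solve 1 (λ i → (con 1 :+ (con 1 :+ con 0)) :* i
           := con 0 :+ con 1 :* i :+ (con 0 :+ con 1 :* i))
         refl (ι 2 ⁻¹) ⟩
    0# + 1# / ι 2 + (0# + 1# / ι 2)   ≤⟨ +-mono-≤ half half ⟩
    ln (ι n) + ln (ι n)               ∎
    where
    0<2 : 0# < ι 2
    0<2 = ι-pos {2} λ ()
    half : 0# + 1# / ι 2 ≤ ln (ι n)
    half = begin
      0# + 1# / ι 2    ≈⟨ +-congʳ ln-1 ⟨
      ln 1# + 1# / ι 2 ≤⟨ ln-increment 0<1 0<2 (+-congˡ (sym (+-identityʳ 1#))) ⟩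
      ln (ι 2)         ≤⟨ ln-mono 0<2 (ι-mono 2≤n) ⟩
      ln (ι n)         ∎

  -- Indicators and finite sums.

  𝟙 : Bool → ℝ
  𝟙 b = if b then 1# else 0#

  𝟙-nonNeg : ∀ b → 0# ≤ 𝟙 b
  𝟙-nonNeg true  = 0≤1
  𝟙-nonNeg false = ≤-refl

  𝟙≤1 : ∀ b → 𝟙 b ≤ 1#
  𝟙≤1 true  = ≤-refl
  𝟙≤1 false = 0≤1

  -- The factors are swapped so that in `∑d` the indicator that is constant in the inner sum stands
  -- in front.
  𝟙-∧ : ∀ a b → 𝟙 (a ∧ b) ≈ 𝟙 b * 𝟙 a
  𝟙-∧ true  b = sym (*-identityʳ _)
  𝟙-∧ false b = sym (zeroʳ _)

  𝟙-∈ : ∀ {n} {p : Subset n} {i} → i ∈ p → 𝟙 (lookup p i) ≈ 1#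
  𝟙-∈ i∈p = reflexive (≡.cong 𝟙 ([]=⇒lookup i∈p))

  sum-mono : ∀ {n} {f g : Fin n → ℝ} → (∀ i → f i ≤ g i) → sum f ≤ sum g
  sum-mono {zero}  f≤g = ≤-refl
  sum-mono {suc n} f≤g = +-mono-≤ (f≤g zero) (sum-mono (f≤g ∘ suc))

  sum-nonNeg : ∀ {n} {f : Fin n → ℝ} → (∀ i → 0# ≤ f i) → 0# ≤ sum f
  sum-nonNeg {zero}  0≤f = ≤-refl
  sum-nonNeg {suc n} 0≤f = +-nonNeg (0≤f zero) (sum-nonNeg (0≤f ∘ suc))

  term≤sum : ∀ {n} {f : Fin n → ℝ} → (∀ i → 0# ≤ f i) → ∀ i → f i ≤ sum f
  term≤sum 0≤f zero    = x≤x+y (sum-nonNeg (0≤f ∘ suc))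
  term≤sum 0≤f (suc i) = ≤-trans (term≤sum (0≤f ∘ suc) i) (x≤y+x (0≤f zero))

  -- With cardinalities as sums of indicators, double counting becomes an exchange of sums.
  ι-∣∣ : ∀ {n} (p : Subset n) → ι ∣ p ∣ ≈ sum (λ i → 𝟙 (lookup p i))
  ι-∣∣ []          = refl
  ι-∣∣ (true  ∷ p) = +-congˡ (ι-∣∣ p)
  ι-∣∣ (false ∷ p) = trans (ι-∣∣ p) (sym (+-identityˡ _))

  ι-sum : ∀ {n} (f : Fin n → ℕ) → ι (Vector.foldr ℕ._+_ 0 f) ≈ sum (ι ∘ f)
  ι-sum {zero}  f = refl
  ι-sum {suc n} f = trans (ι-+ (f zero) _) (+-congˡ (ι-sum (f ∘ suc)))

-- Sequences of natural numbers and work-time scheduling.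

≤-foldr-⊔ : ∀ {n} (f : Fin n → ℕ) i → f i ℕ.≤ Vector.foldr ℕ._⊔_ 0 f
≤-foldr-⊔ f zero    = ℕ.m≤m⊔n (f zero) _
≤-foldr-⊔ f (suc i) = ℕ.≤-trans (≤-foldr-⊔ (f ∘ suc) i) (ℕ.m≤n⊔m (f zero) _)

n≤sum-applyUpTo : ∀ (q : ℕ → ℕ) n → (∀ k → k ℕ.< n → q k ≢ 0) → n ℕ.≤ ListAction.sum (applyUpTo q n)
n≤sum-applyUpTo q zero    q≢0 = ℕ.z≤n
n≤sum-applyUpTo q (suc n) q≢0 =
  ℕ.+-mono-≤ (ℕ.n≢0⇒n>0 (q≢0 0 (ℕ.s≤s ℕ.z≤n)))
    (n≤sum-applyUpTo (q ∘ suc) n λ k k<n → q≢0 (suc k) (ℕ.s≤s k<n))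

-- Abstracts `HaltsAfter` to an arbitrary sequence; for `edgesAfter I` the two agree by definition.
FirstZero : (ℕ → ℕ) → ℕ → Set
FirstZero q T = q T ≡ 0 × (∀ k → k ℕ.< T → q k ≢ 0)

-- The search is bounded so that it terminates; `halts` chooses a bound that rules out failure.
firstZero? : ∀ (q : ℕ → ℕ) n → ∃ (FirstZero q) ⊎ (∀ k → k ℕ.< n → q k ≢ 0)
firstZero? q zero = inj₂ λ k ()
firstZero? q (suc n) with q 0 ℕ.≟ 0 | firstZero? (q ∘ suc) n
... | yes q0≡0 | _ = inj₁ (0 , q0≡0 , λ k ())
... | no q0≢0 | inj₁ (T , qT≡0 , q≢0) =
  inj₁ (suc T , qT≡0 , λ { zero _ → q0≢0 ; (suc k) (ℕ.s≤s k<T) → q≢0 k k<T })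
... | no q0≢0 | inj₂ q≢0 = inj₂ λ { zero _ → q0≢0 ; (suc k) (ℕ.s≤s k<n) → q≢0 k k<n }

-- Brent's bound: rounding k / p up costs at most one extra step per parallel step, so p ⌈k/p⌉ ≤ k +
-- p. Multiplying through by p keeps the estimate free of divisions.
p*timeOn≤ : ∀ p .{{_ : NonZero p}} s → p ℕ.* timeOn p s ℕ.≤ p ℕ.* time s ℕ.+ operations s
p*timeOn≤ p List.[] = ℕ.m≤m+n _ _
p*timeOn≤ p (k List.∷ s) = begin
  p ℕ.* ((k ℕ.+ ℕ.pred p) ℕ./ p ℕ.+ timeOn p s)                ≡⟨ ℕ.*-distribˡ-+ p _ (timeOn p s) ⟩
  p ℕ.* ((k ℕ.+ ℕ.pred p) ℕ./ p) ℕ.+ p ℕ.* timeOn p s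
    ≤⟨ ℕ.+-mono-≤ p*⌈k/p⌉≤k+p (p*timeOn≤ p s) ⟩
  k ℕ.+ p ℕ.+ (p ℕ.* time s ℕ.+ operations s)
    ≡⟨ rearrange k p (time s) (operations s) ⟩
  p ℕ.* suc (time s) ℕ.+ (k ℕ.+ operations s)                  ∎
  where
  open ℕ.≤-Reasoning
  rearrange : ∀ k p t o → k ℕ.+ p ℕ.+ (p ℕ.* t ℕ.+ o) ≡ p ℕ.* suc t ℕ.+ (k ℕ.+ o)
  rearrange = ℕSolver.solve-∀
  p*⌈k/p⌉≤k+p : p ℕ.* ((k ℕ.+ ℕ.pred p) ℕ./ p) ℕ.≤ k ℕ.+ p
  p*⌈k/p⌉≤k+p = begin
    p ℕ.* ((k ℕ.+ ℕ.pred p) ℕ./ p) ≡⟨ ℕ.*-comm p _ ⟩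
    (k ℕ.+ ℕ.pred p) ℕ./ p ℕ.* p   ≤⟨ ℕ.m/n*n≤m (k ℕ.+ ℕ.pred p) p ⟩
    k ℕ.+ ℕ.pred p                 ≤⟨ ℕ.+-monoʳ-≤ k (ℕ.pred[n]≤n {p}) ⟩
    k ℕ.+ p                        ∎

-- Counting arguments for an abstract decreasing potential.

module Decay (𝓡 : Reals) where
  open Reals 𝓡
  open OrderedField 𝓡
  open Solver using (solve; _:=_; _:+_; _:*_; con)
  open ≤-R

  -- Isolates what the counting arguments use of a run. Later `q k` is the number of edges left
  -- after k iterations and `A` is `ι rank * K`.
  record Potential (A : ℝ) (q : ℕ → ℕ) (Φ : ℕ → ℝ) : Set where
    field
      nonNeg   : ∀ k → 0# ≤ Φ k
      decrease : ∀ k → Φ (suc k) + ι (q k) ≤ Φ k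
      bound    : ∀ k → Φ k ≤ A * ι (q k)
      antitone : ∀ k → q (suc k) ℕ.≤ q k

  shift : ∀ {A q Φ} → Potential A q Φ → Potential A (q ∘ suc) (Φ ∘ suc)
  shift P = record
    { nonNeg   = P.nonNeg ∘ suc
    ; decrease = P.decrease ∘ suc
    ; bound    = P.bound ∘ suc
    ; antitone = P.antitone ∘ suc
    }
    where module P = Potential P

  -- Telescoping: the falls of the potential cannot add up to more than its initial value, as it
  -- stays nonnegative.
  sum≤Φ₀ : ∀ {A q Φ} → Potential A q Φ → ∀ T → ι (ListAction.sum (applyUpTo q T)) ≤ Φ 0
  sum≤Φ₀ P zero = Potential.nonNeg P 0
  sum≤Φ₀ {q = q} {Φ} P (suc T) = begin
    ι (q 0 ℕ.+ ListAction.sum (applyUpTo (q ∘ suc) T))   ≈⟨ ι-+ (q 0) _ ⟩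
    ι (q 0) + ι (ListAction.sum (applyUpTo (q ∘ suc) T)) ≤⟨ +-monoʳ-≤ _ (sum≤Φ₀ (shift P) T) ⟩
    ι (q 0) + Φ 1                                            ≈⟨ +-comm _ _ ⟩
    Φ 1 + ι (q 0)                                            ≤⟨ Potential.decrease P 0 ⟩
    Φ 0                                                      ∎

  -- Take n ≥ Φ 0. If the first n + 1 values of q were all nonzero, they would sum to at least n +
  -- 1, against `sum≤Φ₀`.
  halts : ∀ {A q Φ} → Potential A q Φ → ∃ (FirstZero q)
  halts {q = q} {Φ} P with archimedean (Φ 0)
  ... | n , Φ₀≤n with firstZero? q (suc n)
  ...   | inj₁ halt = halt
  ...   | inj₂ q≢0  = ⊥-elim (<⇒≱ 0<1 (+-cancelʳ-≤ (ι n) (begin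
    1# + ι n                                   ≤⟨ ι-mono (n≤sum-applyUpTo q (suc n) q≢0) ⟩
    ι (ListAction.sum (applyUpTo q (suc n))) ≤⟨ sum≤Φ₀ P (suc n) ⟩
    Φ 0                                        ≤⟨ Φ₀≤n ⟩
    ι n                                        ≈⟨ +-identityˡ (ι n) ⟨
    0# + ι n                                   ∎)))

  -- Ψ = Φ / q + A ln q decreases by at least 1: the growth of Φ / q caused by
  -- a fall of q is at most A times the relative fall, which A ln q pays for.
  Ψ-decrease : ∀ {A x y a b} → 0# ≤ A → 0# < b → b ≤ a → y + a ≤ x → y ≤ A * b →
    1# + (y / b + A * ln b) ≤ x / a + A * ln a
  Ψ-decrease {A} {x} {y} {a} {b} 0≤A 0<b b≤a y+a≤x y≤Ab = begin
    1# + (y / b + A * ln b)                      ≈⟨ +-congˡ (+-congʳ y/b-split) ⟩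
    1# + (y / a + y / b * (s / a) + A * ln b)
      ≤⟨ +-monoʳ-≤ _ (+-monoˡ-≤ _ (+-monoʳ-≤ _ (*-monoʳ-≤ 0≤s/a y/b≤A))) ⟩
    1# + (y / a + A * (s / a) + A * ln b)
      ≈⟨ solve 5 (λ o ya A sa l → o :+ (ya :+ A :* sa :+ A :* l) := ya :+ o :+ A :* (l :+ sa))
         refl 1# (y / a) A (s / a) (ln b) ⟩
    y / a + 1# + A * (ln b + s / a)
      ≤⟨ +-mono-≤ y/a+1≤x/a (*-monoˡ-≤ 0≤A (ln-increment 0<b 0<a b+s≈a)) ⟩
    x / a + A * ln a                             ∎
    where
    s = a - b
    0<a = <-≤-trans 0<b b≤a
    b+s≈a : b + s ≈ a
    b+s≈a = trans (+-comm b s) (x-y+y≈x a b)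
    0≤s/a : 0# ≤ s / a
    0≤s/a = *-nonNeg (x≤y⇒0≤y-x b≤a) (<⇒≤ (⁻¹-pos 0<a))
    y/b≤A : y / b ≤ A
    y/b≤A = *-cancelˡ-≤ 0<b (begin
      b * (y / b) ≈⟨ trans (*-comm b _) (x/y*y≈x y 0<b) ⟩
      y           ≤⟨ y≤Ab ⟩
      A * b       ≈⟨ *-comm A b ⟩
      b * A       ∎)
    -- Splitting 1 as b/a + s/a exposes the growth from y/a to y/b as y/b times the relative fall
    -- s/a, to which `y/b≤A` applies.
    y/b-split : y / b ≈ y / a + y / b * (s / a)
    y/b-split = begin-equality
      y / b                               ≈⟨ *-identityʳ _ ⟨
      y / b * 1#                          ≈⟨ *-congˡ (0<⇒*⁻¹≈1 0<a) ⟨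
      y / b * (a / a)                     ≈⟨ *-congˡ (*-congʳ b+s≈a) ⟨
      y / b * ((b + s) / a)
        ≈⟨ solve 5 (λ y b⁻ b s a⁻ → y :* b⁻ :* ((b :+ s) :* a⁻)
             := y :* b⁻ :* b :* a⁻ :+ y :* b⁻ :* (s :* a⁻))
           refl y (b ⁻¹) b s (a ⁻¹) ⟩
      y / b * b / a + y / b * (s / a)     ≈⟨ +-congʳ (*-congʳ (x/y*y≈x y 0<b)) ⟩
      y / a + y / b * (s / a)             ∎
    y/a+1≤x/a : y / a + 1# ≤ x / a
    y/a+1≤x/a = begin
      y / a + 1#    ≈⟨ +-congˡ (0<⇒*⁻¹≈1 0<a) ⟨
      y / a + a / a ≈⟨ distribʳ _ y a ⟨
      (y + a) / a   ≤⟨ *-monoʳ-≤ (<⇒≤ (⁻¹-pos 0<a)) y+a≤x ⟩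
      x / a         ∎

  -- Ψ divides by q, so the induction ends at the last iteration that still has edges and not at q =
  -- 0. There Ψ is already at least 1: the coming fall forces Φ ≥ q, and ln q ≥ 0.
  iterations≤Ψ₀ : ∀ {A q Φ} → 0# ≤ A → Potential A q Φ → ∀ T → (∀ k → k ℕ.< suc T → q k ≢ 0) →
    ι (suc T) ≤ Φ 0 / ι (q 0) + A * ln (ι (q 0))
  iterations≤Ψ₀ {A} {q} {Φ} 0≤A P zero q≢0 = begin
    1# + 0#                             ≤⟨ +-mono-≤ 1≤Φ₀/q₀ (*-nonNeg 0≤A (0≤ln-ι q₀≢0)) ⟩
    Φ 0 / ι (q 0) + A * ln (ι (q 0))    ∎
    where
    module P = Potential P
    q₀≢0 = q≢0 0 (ℕ.s≤s ℕ.z≤n)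
    0<q₀ = ι-pos q₀≢0
    1≤Φ₀/q₀ : 1# ≤ Φ 0 / ι (q 0)
    1≤Φ₀/q₀ = begin
      1#                ≈⟨ 0<⇒*⁻¹≈1 0<q₀ ⟨
      ι (q 0) / ι (q 0) ≤⟨ *-monoʳ-≤ (<⇒≤ (⁻¹-pos 0<q₀)) (≤-trans (x≤y+x (P.nonNeg 1)) (P.decrease 0)) ⟩
      Φ 0 / ι (q 0)     ∎
  iterations≤Ψ₀ {A} {q} {Φ} 0≤A P (suc T) q≢0 = begin
    1# + ι (suc T)
      ≤⟨ +-monoʳ-≤ 1# (iterations≤Ψ₀ 0≤A (shift P) T (λ k k<T → q≢0 (suc k) (ℕ.s≤s k<T))) ⟩
    1# + (Φ 1 / ι (q 1) + A * ln (ι (q 1)))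
      ≤⟨ Ψ-decrease 0≤A (ι-pos (q≢0 1 (ℕ.s≤s (ℕ.s≤s ℕ.z≤n)))) (ι-mono (P.antitone 0)) (P.decrease 0) (P.bound 1) ⟩
    Φ 0 / ι (q 0) + A * ln (ι (q 0))            ∎
    where module P = Potential P

  -- The initial value of Ψ is estimated by `bound`, which gives Φ 0 / q 0 ≤ A.
  iterations≤ : ∀ {A q Φ T} → 0# ≤ A → Potential A q Φ → q 0 ≢ 0 → FirstZero q T →
    ι T ≤ A * (1# + ln (ι (q 0)))
  iterations≤ {T = zero} 0≤A P q₀≢0 (q₀≡0 , _) = ⊥-elim (q₀≢0 q₀≡0)
  iterations≤ {A} {q} {Φ} {suc T} 0≤A P q₀≢0 (_ , q≢0) = begin
    ι (suc T)                                     ≤⟨ iterations≤Ψ₀ 0≤A P T q≢0 ⟩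
    Φ 0 / ι (q 0) + A * ln (ι (q 0))
      ≤⟨ +-monoˡ-≤ _ (*-monoʳ-≤ (<⇒≤ (⁻¹-pos 0<q₀)) (Potential.bound P 0)) ⟩
    A * ι (q 0) / ι (q 0) + A * ln (ι (q 0))
      ≈⟨ +-congʳ (trans (*-assoc A _ _) (*-congˡ (0<⇒*⁻¹≈1 0<q₀))) ⟩
    A * 1# + A * ln (ι (q 0))                     ≈⟨ distribˡ A 1# _ ⟨
    A * (1# + ln (ι (q 0)))                       ∎
    where 0<q₀ = ι-pos q₀≢0

  antitone₀ : ∀ {A q Φ} → Potential A q Φ → ∀ k → q k ℕ.≤ q 0
  antitone₀ P zero    = ℕ.≤-refl
  antitone₀ P (suc k) = ℕ.≤-trans (Potential.antitone P k) (antitone₀ P k)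

  time-concat≤ : ∀ (f : ℕ → Schedule) {c} T → (∀ k → k ℕ.< T → ι (time (f k)) ≤ c) →
    ι (time (List.concat (applyUpTo f T))) ≤ ι T * c
  time-concat≤ f {c} zero    f≤c = ≤-reflexive (sym (zeroˡ c))
  time-concat≤ f {c} (suc T) f≤c = begin
    ι (time (f 0 List.++ rest))      ≡⟨ ≡.cong ι (List.length-++ (f 0)) ⟩
    ι (time (f 0) ℕ.+ time rest)     ≈⟨ ι-+ (time (f 0)) _ ⟩
    ι (time (f 0)) + ι (time rest)
      ≤⟨ +-mono-≤ (f≤c 0 (ℕ.s≤s ℕ.z≤n)) (time-concat≤ (f ∘ suc) T λ k k<T → f≤c (suc k) (ℕ.s≤s k<T)) ⟩
    c + ι T * c                      ≈⟨ +-congʳ (*-identityˡ c) ⟨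
    1# * c + ι T * c                 ≈⟨ distribʳ c 1# (ι T) ⟨
    ι (suc T) * c                    ∎
    where rest = List.concat (applyUpTo (f ∘ suc) T)

  -- The bound stays proportional to `q k` in every iteration, so the total is governed by the sum
  -- of the `q k` and not by T times the largest of them.
  operations-concat≤ : ∀ (f : ℕ → Schedule) (q : ℕ → ℕ) {c} T →
    (∀ k → k ℕ.< T → ι (operations (f k)) ≤ c * ι (q k)) →
    ι (operations (List.concat (applyUpTo f T))) ≤ c * ι (ListAction.sum (applyUpTo q T))
  operations-concat≤ f q {c} zero    f≤cq = ≤-reflexive (sym (zeroʳ c))
  operations-concat≤ f q {c} (suc T) f≤cq = begin
    ι (operations (f 0 List.++ rest))             ≡⟨ ≡.cong ι (ListAction.sum-++ (f 0) rest) ⟩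
    ι (operations (f 0) ℕ.+ operations rest)      ≈⟨ ι-+ (operations (f 0)) _ ⟩
    ι (operations (f 0)) + ι (operations rest)
      ≤⟨ +-mono-≤ (f≤cq 0 (ℕ.s≤s ℕ.z≤n)) (operations-concat≤ (f ∘ suc) (q ∘ suc) T λ k k<T → f≤cq (suc k) (ℕ.s≤s k<T)) ⟩
    c * ι (q 0) + c * ι q-rest                    ≈⟨ distribˡ c _ _ ⟨
    c * (ι (q 0) + ι q-rest)                      ≈⟨ *-congˡ (ι-+ (q 0) q-rest) ⟨
    c * ι (q 0 ℕ.+ q-rest)                        ∎
    where
    rest   = List.concat (applyUpTo (f ∘ suc) T)
    q-rest = ListAction.sum (applyUpTo (q ∘ suc) T)

-- Conditionals on decisions, and membership in subsets.

if-elim : ∀ {a b} {A : Set a} {B : Set b} (P : B → Set) (A? : Dec A) {x y : B} →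
  (A → P x) → (¬ A → P y) → P (if does A? then x else y)
if-elim P (yes a) Px Py = Px a
if-elim P (no ¬a) Px Py = Py ¬a

∈-tabulate⁺ : ∀ {n} (f : Fin n → Bool) {i} → f i ≡ true → i ∈ tabulate f
∈-tabulate⁺ f {i} fi = lookup⇒[]= i (tabulate f) (≡.trans (lookup∘tabulate f i) fi)

∈-tabulate⁻ : ∀ {n} (f : Fin n → Bool) {i} → i ∈ tabulate f → f i ≡ true
∈-tabulate⁻ f {i} i∈ = ≡.trans (≡.sym (lookup∘tabulate f i)) ([]=⇒lookup i∈)

Empty⇒∣p∣≡0 : ∀ {n} {p : Subset n} → Empty p → ∣ p ∣ ≡ 0
Empty⇒∣p∣≡0 {n} ∅ = ≡.trans (≡.cong ∣_∣ (Empty-unique ∅)) (∣⊥∣≡0 n)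

∈⇒∣p∣≢0 : ∀ {n} {p : Subset n} {i} → i ∈ p → ∣ p ∣ ≢ 0
∈⇒∣p∣≢0 i∈p = ℕ.m<n⇒n≢0 (x∈p⇒∣p-x∣<∣p∣ i∈p)

∈-members : ∀ {n} {p : Subset n} {i} → i ∈ p → i ∈ₗ members p
∈-members {p = p} {i} i∈p = List∈.∈-filter⁺ (_∈? p) (List∈.∈-allFin i) i∈p

members-∈ : ∀ {n} {p : Subset n} {i} → i ∈ₗ members p → i ∈ p
members-∈ {n} {p} i∈ = proj₂ (List∈.∈-filter⁻ (_∈? p) {xs = List.allFin n} i∈)

-- The potential of the algorithm.

module CoverPotential (𝓡 : Reals) (I : Cover.Input 𝓡) where
  open Reals 𝓡
  open OrderedField 𝓡
  open Decay 𝓡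
  open Cover 𝓡
  open Solver using (solve; _:=_; _:+_; _:*_; con)
  open ≤-R
  open Input I
  open Algorithm I hiding (edgesAfter; HaltsAfter)

  -- The value of 1 + ln (w_p / (ε w)) at w_p = w, hence its maximum over undeleted vertices.
  K : ℝ
  K = 1# + ln (1# / ε)

  εw : Fin n → ℝ
  εw v = ε * w v

  0<εw : ∀ v → 0# < εw v
  0<εw v = *-pos ε>0 (w>0 v)

  ∈-incident⁻ : ∀ {v e} → e ∈ incident v → v ∈ edge e
  ∈-incident⁻ {v} {e} e∈ = lookup⇒[]= v (edge e) (∈-tabulate⁻ (λ e → lookup (edge e) v) e∈)

  ∈-incident⁺ : ∀ {v e} → v ∈ edge e → e ∈ incident v
  ∈-incident⁺ {v} {e} v∈ = ∈-tabulate⁺ (λ e → lookup (edge e) v) ([]=⇒lookup v∈)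

  -- `live` and `lower` together make every vertex of a remaining edge have positive residual
  -- weight, so that ratios and logarithms are meaningful. `lower` is the failed deletion test.
  record Invariant (s : State n m) : Set where
    open State s
    field
      live  : ∀ {e v} → e ∈ remaining → v ∈ edge e → v ∉ deleted
      lower : ∀ {v} → v ∉ deleted → εw v < wₚ v
      upper : ∀ {v} → v ∉ deleted → wₚ v ≤ w v

  -- One state: charges, invariant and potential.

  module Step (s : State n m) (inv : Invariant s) where
    open State s
    open Iteration s
    open Invariant inv

    d : Fin n → ℝ
    d v = ι (dₚ v)

    ∈-Eₚ⁻ : ∀ {v e} → e ∈ Eₚ v → v ∈ edge e × e ∈ remaining
    ∈-Eₚ⁻ {v} e∈ with x∈p∩q⁻ (incident v) remaining e∈
    ... | e∈v , e∈r = ∈-incident⁻ e∈v , e∈r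

    ∈-Eₚ⁺ : ∀ {v e} → v ∈ edge e → e ∈ remaining → e ∈ Eₚ v
    ∈-Eₚ⁺ v∈e e∈r = x∈p∩q⁺ (∈-incident⁺ v∈e , e∈r)

    Eₚ-live : ∀ {v e} → e ∈ Eₚ v → v ∉ deleted
    Eₚ-live e∈ = live (proj₂ (∈-Eₚ⁻ e∈)) (proj₁ (∈-Eₚ⁻ e∈))

    deleted⇒dₚ≡0 : ∀ {v} → v ∈ deleted → dₚ v ≡ 0
    deleted⇒dₚ≡0 v∈ = Empty⇒∣p∣≡0 λ (_ , e∈) → Eₚ-live e∈ v∈

    0<wₚ : ∀ {v} → v ∉ deleted → 0# < wₚ v
    0<wₚ {v} v∉ = ≤-<-trans (<⇒≤ (0<εw v)) (lower v∉)

    0<d : ∀ {v e} → e ∈ Eₚ v → 0# < d v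
    0<d e∈ = ι-pos (∈⇒∣p∣≢0 e∈)

    ratio : Fin n → ℝ
    ratio v = wₚ v / d v

    δ≤ratio : ∀ {v e} → v ∈ edge e → δ e ≤ ratio v
    δ≤ratio {v} {e} v∈e =
      All.lookup
        (Extrema.min≤xs totalOrder _ (List.map ratio (members (edge e))))
        (List∈.∈-map⁺ ratio (∈-members v∈e))

    δ-attained : ∀ e → ∃ λ v → v ∈ edge e × δ e ≡ ratio v
    δ-attained e
      with Extrema.argmin-sel totalOrder (λ x → x)
             (ratio (proj₁ (edge-nonempty e))) (List.map ratio (members (edge e)))
    -- The default argument of `min` is itself the ratio of a vertex of `e`, so this case also
    -- yields a witness.
    ... | inj₁ eq = _ , proj₂ (edge-nonempty e) , eq
    ... | inj₂ δ∈ with List∈.∈-map⁻ ratio δ∈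
    ...   | v , v∈ , eq = v , members-∈ v∈ , eq

    charge : Fin n → Fin m → ℝ
    charge v e = if does (e ∈? Eₚ v) then δ e else 0#

    loss : Fin n → ℝ
    loss v = sum (charge v)

    -- The potential released per unit of weight taken off v; it is the reciprocal of `ratio v` when
    -- v lies in a remaining edge.
    ρ : Fin n → ℝ
    ρ v = d v / wₚ v

    ratio*ρ : ∀ {v e} → e ∈ Eₚ v → ratio v * ρ v ≈ 1#
    ratio*ρ {v} e∈ = begin-equality
      wₚ v / d v * (d v / wₚ v)  ≈⟨ *-assoc _ (d v) _ ⟨
      wₚ v / d v * d v / wₚ v    ≈⟨ *-congʳ (x/y*y≈x (wₚ v) (0<d e∈)) ⟩
      wₚ v / wₚ v                ≈⟨ 0<⇒*⁻¹≈1 (0<wₚ (Eₚ-live e∈)) ⟩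
      1#                         ∎

    0≤ρ : ∀ {v} → v ∉ deleted → 0# ≤ ρ v
    0≤ρ {v} v∉ = *-nonNeg (ι-nonNeg (dₚ v)) (<⇒≤ (⁻¹-pos (0<wₚ v∉)))

    0≤δ : ∀ {e} → e ∈ remaining → 0# ≤ δ e
    0≤δ {e} e∈ with δ-attained e
    ... | v , v∈e , eq = ≤-trans
      (<⇒≤ (*-pos (0<wₚ (live e∈ v∈e)) (⁻¹-pos (0<d (∈-Eₚ⁺ v∈e e∈)))))
      (≤-reflexive (reflexive (≡.sym eq)))

    0≤charge : ∀ v e → 0# ≤ charge v e
    0≤charge v e = if-elim (0# ≤_) (e ∈? Eₚ v) (λ e∈ → 0≤δ (proj₂ (∈-Eₚ⁻ e∈))) (λ _ → ≤-refl)

    0≤charge*ρ : ∀ v e → 0# ≤ charge v e * ρ v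
    0≤charge*ρ v e = if-elim (λ c → 0# ≤ c * ρ v) (e ∈? Eₚ v)
      (λ e∈ → *-nonNeg (0≤δ (proj₂ (∈-Eₚ⁻ e∈))) (0≤ρ (Eₚ-live e∈)))
      (λ _ → ≤-reflexive (sym (zeroˡ (ρ v))))

    -- Each remaining edge at v charges it at most `ratio v`, hence contributes at most 1, and there
    -- are `dₚ v` such edges.
    loss*ρ≤d : ∀ v → loss v * ρ v ≤ d v
    loss*ρ≤d v = begin
      loss v * ρ v                          ≈⟨ *-distribʳ-sum (ρ v) (charge v) ⟩
      sum (λ e → charge v e * ρ v)          ≤⟨ sum-mono charge*ρ≤1 ⟩
      sum (λ e → 𝟙 (lookup (Eₚ v) e))       ≈⟨ ι-∣∣ (Eₚ v) ⟨
      d v                                   ∎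
      where
      charge*ρ≤1 : ∀ e → charge v e * ρ v ≤ 𝟙 (lookup (Eₚ v) e)
      charge*ρ≤1 e = if-elim (λ c → c * ρ v ≤ 𝟙 (lookup (Eₚ v) e)) (e ∈? Eₚ v)
        (λ e∈ → begin
          δ e * ρ v               ≤⟨ *-monoʳ-≤ (0≤ρ (Eₚ-live e∈)) (δ≤ratio (proj₁ (∈-Eₚ⁻ e∈))) ⟩
          ratio v * ρ v           ≈⟨ ratio*ρ e∈ ⟩
          1#                      ≈⟨ 𝟙-∈ e∈ ⟨
          𝟙 (lookup (Eₚ v) e)     ∎)
        (λ _ → ≤-trans (≤-reflexive (zeroˡ (ρ v))) (𝟙-nonNeg _))

    -- The vertex that attains the minimum in `δ e` contributes exactly 1, and all other
    -- contributions are nonnegative.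
    edge-charge : ∀ e → 𝟙 (lookup remaining e) ≤ sum (λ v → charge v e * ρ v)
    edge-charge e with lookup remaining e in eq
    ... | false = sum-nonNeg (λ v → 0≤charge*ρ v e)
    ... | true with lookup⇒[]= e remaining eq | δ-attained e
    ...   | e∈ | v , v∈e , δ≡ratio = begin
      1#                              ≈⟨ ratio*ρ (∈-Eₚ⁺ v∈e e∈) ⟨
      ratio v * ρ v                   ≡⟨ ≡.cong (_* ρ v) δ≡ratio ⟨
      δ e * ρ v
        ≤⟨ if-elim (λ c → δ e * ρ v ≤ c * ρ v) (e ∈? Eₚ v) (λ _ → ≤-refl) (λ e∉ → ⊥-elim (e∉ (∈-Eₚ⁺ v∈e e∈))) ⟩
      charge v e * ρ v                ≤⟨ term≤sum (λ v → 0≤charge*ρ v e) v ⟩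
      sum (λ v → charge v e * ρ v)    ∎

    -- Double counting of the charges: every remaining edge accounts for at least 1, and exchanging
    -- the sums groups the charges by vertex.
    q≤∑loss*ρ : ι ∣ remaining ∣ ≤ sum (λ v → loss v * ρ v)
    q≤∑loss*ρ = begin
      ι ∣ remaining ∣                              ≈⟨ ι-∣∣ remaining ⟩
      sum (λ e → 𝟙 (lookup remaining e))           ≤⟨ sum-mono edge-charge ⟩
      sum (λ e → sum (λ v → charge v e * ρ v))     ≈⟨ ∑-comm (λ e v → charge v e * ρ v) ⟩
      sum (λ v → sum (λ e → charge v e * ρ v))
        ≈⟨ sum-cong-≋ (λ v → *-distribʳ-sum (ρ v) (charge v)) ⟨
      sum (λ v → loss v * ρ v)                     ∎

    wₚ′+loss : ∀ {v} → v ∉ deleted → wₚ′ v + loss v ≈ wₚ v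
    wₚ′+loss {v} v∉ = if-elim (λ x → x + loss v ≈ wₚ v) (v ∈? deleted)
      (λ v∈ → ⊥-elim (v∉ v∈)) (λ _ → x-y+y≈x (wₚ v) (loss v))

    deleted⊆deleted′ : deleted ⊆ deleted′
    deleted⊆deleted′ {v} v∈ = ∈-tabulate⁺ _
      (≡.cong (_∨ does (wₚ′ v ≤? ε * w v)) (dec-true (v ∈? deleted) v∈))

    deleted′-lower : ∀ {v} → v ∉ deleted′ → εw v < wₚ′ v
    deleted′-lower {v} v∉ = ≰⇒> λ wₚ′≤ → v∉ (∈-tabulate⁺ _
      (≡.trans (≡.cong (does (v ∈? deleted) ∨_) (dec-true (wₚ′ v ≤? ε * w v) wₚ′≤)) (∨-zeroʳ _)))

    survives : Fin m → Bool
    survives e = does (e ∈? remaining) ∧ not (does (nonempty? (edge e ∩ deleted′)))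

    remaining′⊆remaining : remaining′ ⊆ remaining
    remaining′⊆remaining {e} e∈ with e ∈? remaining | ∈-tabulate⁻ survives e∈
    ... | yes e∈r | _ = e∈r
    ... | no  _   | ()

    live′ : ∀ {e v} → e ∈ remaining′ → v ∈ edge e → v ∉ deleted′
    live′ {e} {v} e∈ v∈e v∈d′
      with e ∈? remaining | nonempty? (edge e ∩ deleted′) | ∈-tabulate⁻ survives e∈
    ... | yes _ | no ∅  | _ = ∅ (v , x∈p∩q⁺ (v∈e , v∈d′))
    ... | yes _ | yes _ | ()
    ... | no _  | _     | ()

    invariant′ : Invariant next
    invariant′ = record
      { live  = live′
      ; lower = deleted′-lower
      ; upper = λ {v} v∉′ → let v∉ = λ v∈ → v∉′ (deleted⊆deleted′ v∈) in begin
          wₚ′ v            ≤⟨ x≤x+y (sum-nonNeg (0≤charge v)) ⟩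
          wₚ′ v + loss v   ≈⟨ wₚ′+loss v∉ ⟩
          wₚ v             ≤⟨ upper v∉ ⟩
          w v              ∎
      }

    -- This is ln (w_p / (ε w)), written as a difference because an iteration changes only the first
    -- logarithm.
    g : Fin n → ℝ
    g v = ln (wₚ v) - ln (εw v)

    -- The summand 1 keeps the term at least `d v` even when w_p is barely above ε w; this is what
    -- pays for the deletion of v.
    φ : Fin n → ℝ
    φ v = d v * (1# + g v)

    0≤g : ∀ {v} → v ∉ deleted → 0# ≤ g v
    0≤g {v} v∉ = x≤y⇒0≤y-x (ln-mono (0<εw v) (<⇒≤ (lower v∉)))

    1+g≤K : ∀ {v} → v ∉ deleted → 1# + g v ≤ K
    1+g≤K {v} v∉ = +-monoʳ-≤ 1# (+-cancelʳ-≤ (ln (εw v)) (begin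
      g v + ln (εw v)                          ≈⟨ x-y+y≈x _ _ ⟩
      ln (wₚ v)                                ≤⟨ ln-mono (0<wₚ v∉) (upper v∉) ⟩
      ln (w v)                                 ≈⟨ +-identityˡ _ ⟨
      0# + ln (w v)                            ≈⟨ +-congʳ (ln-1/ ε>0) ⟨
      ln (1# / ε) + ln ε + ln (w v)            ≈⟨ +-assoc _ _ _ ⟩
      ln (1# / ε) + (ln ε + ln (w v))          ≈⟨ +-congˡ (ln-* ε>0 (w>0 v)) ⟨
      ln (1# / ε) + ln (εw v)                  ∎))

    d≈0 : ∀ {v} → v ∈ deleted → d v ≈ 0#
    d≈0 v∈ = reflexive (≡.cong ι (deleted⇒dₚ≡0 v∈))

    -- The residual weight of a deleted vertex need not be positive, so its logarithm may be
    -- unspecified; the degree 0 removes it from the potential.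
    φ≈0 : ∀ {v} → v ∈ deleted → φ v ≈ 0#
    φ≈0 v∈ = trans (*-congʳ (d≈0 v∈)) (zeroˡ _)

    d≤φ : ∀ v → d v ≤ φ v
    d≤φ v with v ∈? deleted
    ... | yes v∈ = ≤-reflexive (trans (d≈0 v∈) (sym (φ≈0 v∈)))
    ... | no v∉ = begin
      d v         ≈⟨ *-identityʳ (d v) ⟨
      d v * 1#    ≤⟨ *-monoˡ-≤ (ι-nonNeg (dₚ v)) (x≤x+y (0≤g v∉)) ⟩
      φ v         ∎

    φ≤dK : ∀ v → φ v ≤ d v * K
    φ≤dK v with v ∈? deleted
    ... | yes v∈ = ≤-reflexive (trans (φ≈0 v∈) (sym (trans (*-congʳ (d≈0 v∈)) (zeroˡ K))))
    ... | no v∉  = *-monoˡ-≤ (ι-nonNeg (dₚ v)) (1+g≤K v∉)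

    Φ : ℝ
    Φ = sum φ

    0≤Φ : 0# ≤ Φ
    0≤Φ = sum-nonNeg λ v → ≤-trans (ι-nonNeg (dₚ v)) (d≤φ v)

    -- Counts the remaining incidences by edges instead of vertices. Bounding each edge size by the
    -- rank gives `∑d≤rq`, and bounding each indicator by 1 gives `∑d≤size`.
    ∑d : sum d ≈ sum (λ e → 𝟙 (lookup remaining e) * ι ∣ edge e ∣)
    ∑d = begin-equality
      sum d
        ≈⟨ sum-cong-≋ (λ v → ι-∣∣ (Eₚ v)) ⟩
      sum (λ v → sum (λ e → 𝟙 (lookup (Eₚ v) e)))
        ≈⟨ ∑-comm (λ v e → 𝟙 (lookup (Eₚ v) e)) ⟩
      sum (λ e → sum (λ v → 𝟙 (lookup (Eₚ v) e)))
        ≈⟨ sum-cong-≋ (λ e → sum-cong-≋ (λ v → 𝟙-Eₚ v e)) ⟩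
      sum (λ e → sum (λ v → 𝟙 (lookup remaining e) * 𝟙 (lookup (edge e) v)))
        ≈⟨ sum-cong-≋ (λ e → *-distribˡ-sum (𝟙 (lookup remaining e)) (λ v → 𝟙 (lookup (edge e) v))) ⟨
      sum (λ e → 𝟙 (lookup remaining e) * sum (λ v → 𝟙 (lookup (edge e) v)))
        ≈⟨ sum-cong-≋ (λ e → *-congˡ (ι-∣∣ (edge e))) ⟨
      sum (λ e → 𝟙 (lookup remaining e) * ι ∣ edge e ∣)                    ∎
      where
      𝟙-Eₚ : ∀ v e → 𝟙 (lookup (Eₚ v) e) ≈ 𝟙 (lookup remaining e) * 𝟙 (lookup (edge e) v)
      𝟙-Eₚ v e = trans
        (reflexive (≡.cong 𝟙 (≡.trans (lookup-zipWith _∧_ e (incident v) remaining)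
          (≡.cong (_∧ lookup remaining e) (lookup∘tabulate (λ e → lookup (edge e) v) e)))))
        (𝟙-∧ (lookup (edge e) v) (lookup remaining e))

    Φ≤∑d*K : Φ ≤ sum d * K
    Φ≤∑d*K = ≤-trans (sum-mono φ≤dK) (≤-reflexive (sym (*-distribʳ-sum K d)))

    ∑d≤rq : sum d ≤ ι rank * ι ∣ remaining ∣
    ∑d≤rq = begin
      sum d                                             ≈⟨ ∑d ⟩
      sum (λ e → 𝟙 (lookup remaining e) * ι ∣ edge e ∣)
        ≤⟨ sum-mono (λ e → *-monoˡ-≤ (𝟙-nonNeg _) (ι-mono (≤-foldr-⊔ (λ e → ∣ edge e ∣) e))) ⟩
      sum (λ e → 𝟙 (lookup remaining e) * ι rank)
        ≈⟨ *-distribʳ-sum (ι rank) (λ e → 𝟙 (lookup remaining e)) ⟨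
      sum (λ e → 𝟙 (lookup remaining e)) * ι rank       ≈⟨ *-congʳ (ι-∣∣ remaining) ⟨
      ι ∣ remaining ∣ * ι rank                          ≈⟨ *-comm _ _ ⟩
      ι rank * ι ∣ remaining ∣                          ∎

    ∑d≤size : sum d ≤ ι size
    ∑d≤size = begin
      sum d                                             ≈⟨ ∑d ⟩
      sum (λ e → 𝟙 (lookup remaining e) * ι ∣ edge e ∣)
        ≤⟨ sum-mono (λ e → ≤-trans (*-monoʳ-≤ (ι-nonNeg ∣ edge e ∣) (𝟙≤1 (lookup remaining e))) (≤-reflexive (*-identityˡ _))) ⟩
      sum (λ e → ι ∣ edge e ∣)                          ≈⟨ ι-sum (λ e → ∣ edge e ∣) ⟨
      ι size                                            ∎

  -- The fall of the potential in one iteration.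

  module _ (s : State n m) (inv : Invariant s) where
    open State s
    open Iteration s
    open Step s inv
    private module Next = Step next invariant′

    Eₚ-antitone : ∀ v → Iteration.Eₚ next v ⊆ Eₚ v
    Eₚ-antitone v e∈ with Next.∈-Eₚ⁻ e∈
    ... | v∈e , e∈r = ∈-Eₚ⁺ v∈e (remaining′⊆remaining e∈r)

    φ-decrease : ∀ v → Next.φ v + loss v * ρ v ≤ φ v
    φ-decrease v with v ∈? deleted′
    -- This case covers vertices deleted in this iteration and earlier ones alike.
    ... | yes v∈ = begin
      Next.φ v + loss v * ρ v   ≈⟨ +-congʳ (Next.φ≈0 v∈) ⟩
      0# + loss v * ρ v         ≈⟨ +-identityˡ _ ⟩
      loss v * ρ v              ≤⟨ loss*ρ≤d v ⟩
      d v                       ≤⟨ d≤φ v ⟩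
      φ v                       ∎
    ... | no v∉′ = begin
      Next.d v * (1# + Next.g v) + loss v * (d v / wₚ v)
        -- The degree is first raised to its old value, which is allowed because the other factor is
        -- nonnegative; then only the logarithm has to be compared.
        ≤⟨ +-monoˡ-≤ _ (*-monoʳ-≤ 0≤1+g′ (ι-mono (p⊆q⇒∣p∣≤∣q∣ (Eₚ-antitone v)))) ⟩
      d v * (1# + Next.g v) + loss v * (d v / wₚ v)
        ≈⟨ solve 5 (λ d o g l i → d :* (o :+ g) :+ l :* (d :* i) := d :* (o :+ (g :+ l :* i)))
           refl (d v) 1# (Next.g v) (loss v) (wₚ v ⁻¹) ⟩
      d v * (1# + (Next.g v + loss v / wₚ v))
        ≤⟨ *-monoˡ-≤ (ι-nonNeg (dₚ v)) (+-monoʳ-≤ 1# g-decrease) ⟩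
      d v * (1# + g v)                                     ∎
      where
      v∉ = λ v∈ → v∉′ (deleted⊆deleted′ v∈)
      0≤1+g′ : 0# ≤ 1# + Next.g v
      0≤1+g′ = +-nonNeg 0≤1 (Next.0≤g v∉′)
      g-decrease : Next.g v + loss v / wₚ v ≤ g v
      g-decrease = begin
        ln (wₚ′ v) - ln (εw v) + loss v / wₚ v
          ≈⟨ solve 3 (λ a b c → a :+ b :+ c := a :+ c :+ b) refl _ _ _ ⟩
        ln (wₚ′ v) + loss v / wₚ v - ln (εw v)
          ≤⟨ +-monoˡ-≤ _ (ln-increment (Next.0<wₚ v∉′) (0<wₚ v∉) (wₚ′+loss v∉)) ⟩
        ln (wₚ v) - ln (εw v)                     ∎

    Φ-decrease : Next.Φ + ι ∣ remaining ∣ ≤ Φ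
    Φ-decrease = begin
      Next.Φ + ι ∣ remaining ∣                     ≤⟨ +-monoʳ-≤ _ q≤∑loss*ρ ⟩
      sum Next.φ + sum (λ v → loss v * ρ v)        ≈⟨ ∑-distrib-+ Next.φ (λ v → loss v * ρ v) ⟨
      sum (λ v → Next.φ v + loss v * ρ v)          ≤⟨ sum-mono φ-decrease ⟩
      Φ                                            ∎

  -- The potential along a whole run with ε < 1.

  module _ (ε<1 : ε < 1#) where

    invariant₀ : Invariant initial
    invariant₀ = record
      { live  = λ _ _ → ∉⊥
      -- No deletion test has been made yet, so the lower bound comes from ε < 1.
      ; lower = λ {v} _ → ε<1⇒εw<w v
      ; upper = λ _ → ≤-refl
      }
      where
      ε<1⇒εw<w : ∀ v → εw v < w v
      ε<1⇒εw<w v = ≰⇒> λ w≤εw → <⇒≱ ε<1 (*-cancelˡ-≤ (w>0 v) (begin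
        w v * 1#   ≈⟨ *-identityʳ (w v) ⟩
        w v        ≤⟨ w≤εw ⟩
        ε * w v    ≈⟨ *-comm ε (w v) ⟩
        w v * ε    ∎))

    invariant : ∀ k → Invariant (stateAfter k)
    invariant zero    = invariant₀
    invariant (suc k) = Step.invariant′ (stateAfter k) (invariant k)

    Φₖ : ℕ → ℝ
    Φₖ k = Step.Φ (stateAfter k) (invariant k)

    0≤ln1/ε : 0# ≤ ln (1# / ε)
    0≤ln1/ε = ≤-trans (x≤y⇒0≤y-x (<⇒≤ ε<1)) (1-x≤ln[1/x] ε>0)

    0≤K : 0# ≤ K
    0≤K = +-nonNeg 0≤1 0≤ln1/ε

    -- Used for the total work in place of `bound` at 0, so that the result is in terms of M and not
    -- of r m.
    Φ₀≤MK : Φₖ 0 ≤ ι size * K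
    Φ₀≤MK = ≤-trans (Step.Φ≤∑d*K _ invariant₀) (*-monoʳ-≤ 0≤K (Step.∑d≤size _ invariant₀))

    potential : Potential (ι rank * K) (edgesAfter I) Φₖ
    potential = record
      { nonNeg   = λ k → Step.0≤Φ (stateAfter k) (invariant k)
      ; decrease = λ k → Φ-decrease (stateAfter k) (invariant k)
      ; bound    = λ k → let open Step (stateAfter k) (invariant k); q = ι (edgesAfter I k) in begin
          Φ                    ≤⟨ Φ≤∑d*K ⟩
          sum d * K            ≤⟨ *-monoʳ-≤ 0≤K ∑d≤rq ⟩
          ι rank * q * K       ≈⟨ solve 3 (λ r q K → r :* q :* K := r :* K :* q) refl (ι rank) q K ⟩
          ι rank * K * q       ∎
      ; antitone = λ k → p⊆q⇒∣p∣≤∣q∣ (Step.remaining′⊆remaining (stateAfter k) (invariant k))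
      }

-- Time, work and processor bounds.

mainTheorem1 : (𝓡 : Reals) →
    let open Reals 𝓡
        open Cover 𝓡
    in
    (P : Implementation) (ε₀ : ℝ) → ε₀ < 1# →
    ∃ λ (C : ℝ) →
    (I : Input) →
    let open Input I
        open Implementation P
        r = ι rank
        M = ι size
        L = ln² (ι m)
    in
    2 ℕ.≤ m → ε ≤ ε₀ →
    ∃ λ (T : ℕ) →
      HaltsAfter I T
      × ι (time (run I T)) ≤ C * (r * L * ln (1# / ε))
      × ι (operations (run I T)) ≤ C * (r * M * ln (1# / ε))
      × ((p : ℕ) .{{_ : NonZero p}} → M / L < ι (suc p) →
           ι (timeOn p (run I T)) ≤ C * (r * L * ln (1# / ε)))
mainTheorem1 𝓡 P ε₀ ε₀<1 = C , bounds
  where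
  open Reals 𝓡
  open Cover 𝓡
  open OrderedField 𝓡
  open Decay 𝓡
  open Implementation P
  open Solver using (solve; _:=_; _:+_; _:*_; con)
  open ≤-R

  -- The constants of an implementation carry no sign condition; nonnegative upper bounds for them
  -- allow multiplication of inequalities.
  positivePart : ∀ x → ∃ λ y → x ≤ y × 0# ≤ y
  positivePart x with total x 0#
  ... | inj₁ x≤0 = 0# , x≤0 , ≤-refl
  ... | inj₂ 0≤x = x , ≤-refl , 0≤x

  a⁺ = proj₁ (positivePart a)
  b⁺ = proj₁ (positivePart b)
  a≤a⁺ = proj₁ (proj₂ (positivePart a))
  b≤b⁺ = proj₁ (proj₂ (positivePart b))
  0≤a⁺ = proj₂ (proj₂ (positivePart a))
  0≤b⁺ = proj₂ (proj₂ (positivePart b))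

  η = 1# - ε₀

  0<η : 0# < η
  0<η = ≰⇒> λ η≤0 → <⇒≱ ε₀<1 (begin
    1#          ≈⟨ x-y+y≈x 1# ε₀ ⟨
    η + ε₀      ≤⟨ +-monoˡ-≤ ε₀ η≤0 ⟩
    0# + ε₀     ≈⟨ +-identityˡ ε₀ ⟩
    ε₀          ∎)

  -- `κ` comes from K ≤ κ ln (1/ε), and the square of `3#` from using 1 + ln m ≤ 3 ln m twice. `C₂`
  -- is doubled because the processor bound uses M ≤ 2 p ln² m.
  κ 3# C₁ C₂ C : ℝ
  κ  = 1# + η ⁻¹
  3# = 1# + 1# + 1#
  C₁ = a⁺ * κ * (3# * 3#)
  C₂ = b⁺ * κ
  C  = C₁ + (C₂ + C₂)

  0≤κ : 0# ≤ κ
  0≤κ = +-nonNeg 0≤1 (<⇒≤ (⁻¹-pos 0<η))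

  0≤3 : 0# ≤ 3#
  0≤3 = +-nonNeg (+-nonNeg 0≤1 0≤1) 0≤1

  0≤C₁ : 0# ≤ C₁
  0≤C₁ = *-nonNeg (*-nonNeg 0≤a⁺ 0≤κ) (*-nonNeg 0≤3 0≤3)

  0≤C₂ : 0# ≤ C₂
  0≤C₂ = *-nonNeg 0≤b⁺ 0≤κ

  module Bounds (I : Input) (2≤m : 2 ℕ.≤ Input.m I) (ε≤ε₀ : Input.ε I ≤ ε₀) where
    open Input I
    r M L ℓ Λ K : ℝ
    r = ι rank
    M = ι size
    ℓ = ln (ι m)
    L = ln² (ι m)
    Λ = ln (1# / ε)
    K = 1# + Λ

    q = edgesAfter I

    ε<1 : ε < 1#
    ε<1 = ≤-<-trans ε≤ε₀ ε₀<1

    open CoverPotential 𝓡 I using (potential; Φₖ; Φ₀≤MK; 0≤ln1/ε; 0≤K)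

    pot : Potential (r * K) q (Φₖ ε<1)
    pot = potential ε<1

    0≤Λ : 0# ≤ Λ
    0≤Λ = 0≤ln1/ε ε<1

    η≤Λ : η ≤ Λ
    η≤Λ = ≤-trans (+-cancelʳ-≤ (ε + ε₀) (begin
      1# - ε₀ + (ε + ε₀)
        ≈⟨ solve 4 (λ o n e f → o :+ n :+ (e :+ f) := o :+ n :+ f :+ e) refl 1# (- ε₀) ε ε₀ ⟩
      1# - ε₀ + ε₀ + ε    ≈⟨ +-congʳ (x-y+y≈x 1# ε₀) ⟩
      1# + ε              ≤⟨ +-monoʳ-≤ 1# ε≤ε₀ ⟩
      1# + ε₀             ≈⟨ +-congʳ (x-y+y≈x 1# ε) ⟨
      1# - ε + ε + ε₀     ≈⟨ +-assoc _ ε ε₀ ⟩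
      1# - ε + (ε + ε₀)   ∎)) (1-x≤ln[1/x] ε>0)

    -- From ε ≤ ε₀ follows Λ ≥ 1 - ε ≥ η > 0, so the summand 1 of `K` is at most Λ/η.
    K≤κΛ : K ≤ κ * Λ
    K≤κΛ = begin
      1# + Λ               ≈⟨ +-congʳ (0<⇒*⁻¹≈1 0<η) ⟨
      η * η ⁻¹ + Λ         ≤⟨ +-monoˡ-≤ Λ (*-monoʳ-≤ (<⇒≤ (⁻¹-pos 0<η)) η≤Λ) ⟩
      Λ * η ⁻¹ + Λ         ≈⟨ solve 2 (λ l h → l :* h :+ l := (con 1 :+ h) :* l) refl Λ (η ⁻¹) ⟩
      κ * Λ                ∎

    m≢0 : m ≢ 0
    m≢0 m≡0 with ≡.subst (2 ℕ.≤_) m≡0 2≤m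
    ... | ()

    0≤ℓ : 0# ≤ ℓ
    0≤ℓ = 0≤ln-ι m≢0

    1+ℓ≤3ℓ : 1# + ℓ ≤ 3# * ℓ
    1+ℓ≤3ℓ = begin
      1# + ℓ      ≤⟨ +-monoˡ-≤ ℓ (1≤2ln-ι 2≤m) ⟩
      ℓ + ℓ + ℓ   ≈⟨ solve 1 (λ l → l :+ l :+ l := con 3 :* l) refl ℓ ⟩
      3# * ℓ      ∎

    0≤1+ℓ : 0# ≤ 1# + ℓ
    0≤1+ℓ = +-nonNeg 0≤1 0≤ℓ

    0<L : 0# < L
    0<L = *-pos 0<ℓ 0<ℓ
      where
      0<ℓ : 0# < ℓ
      0<ℓ = ≰⇒> λ ℓ≤0 → <⇒≱ 0<1 (begin
        1#        ≤⟨ 1≤2ln-ι 2≤m ⟩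
        ℓ + ℓ     ≤⟨ +-mono-≤ ℓ≤0 ℓ≤0 ⟩
        0# + 0#   ≈⟨ +-identityˡ 0# ⟩
        0#        ∎)

    0≤r : 0# ≤ r
    0≤r = ι-nonNeg rank

    0≤M : 0# ≤ M
    0≤M = ι-nonNeg size

    0≤rLΛ : 0# ≤ r * L * Λ
    0≤rLΛ = *-nonNeg (*-nonNeg 0≤r (<⇒≤ 0<L)) 0≤Λ

    T = proj₁ (halts pot)

    halt : HaltsAfter I T
    halt = proj₂ (halts pot)

    q₀≡m : q 0 ≡ m
    q₀≡m = ∣⊤∣≡n m

    T≤ : ι T ≤ r * K * (1# + ℓ)
    -- Initially all edges remain, but `q 0` equals m only propositionally.
    T≤ = ≡.subst (λ n → ι T ≤ r * K * (1# + ln (ι n))) q₀≡m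
      (iterations≤ (*-nonNeg 0≤r (0≤K ε<1)) pot (λ q₀≡0 → m≢0 (≡.trans (≡.sym q₀≡m) q₀≡0)) halt)

    -- One factor 1 + ln m counts the iterations and the other bounds the time of each, whence ln²
    -- m.
    time≤ : ι (time (run I T)) ≤ C₁ * (r * L * Λ)
    time≤ = begin
      ι (time (run I T))                                  ≤⟨ time-concat≤ (iteration I) T iteration≤ ⟩
      ι T * (a⁺ * (1# + ℓ))                               ≤⟨ *-monoʳ-≤ (*-nonNeg 0≤a⁺ 0≤1+ℓ) T≤ ⟩
      r * K * (1# + ℓ) * (a⁺ * (1# + ℓ))
        ≈⟨ solve 4 (λ r K l a → r :* K :* l :* (a :* l) := a :* r :* (K :* (l :* l)))
           refl r K (1# + ℓ) a⁺ ⟩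
      a⁺ * r * (K * ((1# + ℓ) * (1# + ℓ)))                ≤⟨ *-monoˡ-≤ (*-nonNeg 0≤a⁺ 0≤r)
                                                               (*-mono-≤ (0≤K ε<1) (*-nonNeg 0≤3ℓ 0≤3ℓ) K≤κΛ
          (*-mono-≤ 0≤1+ℓ 0≤3ℓ 1+ℓ≤3ℓ 1+ℓ≤3ℓ)) ⟩
      a⁺ * r * (κ * Λ * (3# * ℓ * (3# * ℓ)))
        ≈⟨ solve 6 (λ a r k t l x → a :* r :* (k :* x :* (t :* l :* (t :* l)))
             := a :* k :* (t :* t) :* (r :* (l :* l) :* x))
           refl a⁺ r κ 3# ℓ Λ ⟩
      C₁ * (r * L * Λ)                                    ∎
      where
      0≤3ℓ : 0# ≤ 3# * ℓ
      0≤3ℓ = *-nonNeg 0≤3 0≤ℓ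
      iteration≤ : ∀ k → k ℕ.< T → ι (time (iteration I k)) ≤ a⁺ * (1# + ℓ)
      iteration≤ k k<T = begin
        ι (time (iteration I k))     ≤⟨ iteration-time I k qₖ≢0 ⟩
        a * (1# + ln (ι (q k)))      ≤⟨ *-monoʳ-≤ (+-nonNeg 0≤1 (0≤ln-ι qₖ≢0)) a≤a⁺ ⟩
        a⁺ * (1# + ln (ι (q k)))     ≤⟨ *-monoˡ-≤ 0≤a⁺ (+-monoʳ-≤ 1# (ln-mono (ι-pos qₖ≢0)
                                          (ι-mono (≡.subst (q k ℕ.≤_) q₀≡m (antitone₀ pot k))))) ⟩
        a⁺ * (1# + ℓ)                ∎
        where qₖ≢0 = proj₂ halt k k<T

    operations≤ : ι (operations (run I T)) ≤ C₂ * (r * M * Λ)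
    operations≤ = begin
      ι (operations (run I T))
        ≤⟨ operations-concat≤ (iteration I) q T iteration≤ ⟩
      b⁺ * r * ι (ListAction.sum (applyUpTo q T))
        ≤⟨ *-monoˡ-≤ (*-nonNeg 0≤b⁺ 0≤r) (≤-trans (sum≤Φ₀ pot T) (Φ₀≤MK ε<1)) ⟩
      b⁺ * r * (M * K)
        ≤⟨ *-monoˡ-≤ (*-nonNeg 0≤b⁺ 0≤r) (*-monoˡ-≤ 0≤M K≤κΛ) ⟩
      b⁺ * r * (M * (κ * Λ))
        ≈⟨ solve 5 (λ b r M k x → b :* r :* (M :* (k :* x)) := b :* k :* (r :* M :* x))
           refl b⁺ r M κ Λ ⟩
      C₂ * (r * M * Λ)                                    ∎
      where
      iteration≤ : ∀ k → k ℕ.< T → ι (operations (iteration I k)) ≤ b⁺ * r * ι (q k)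
      iteration≤ k k<T = begin
        ι (operations (iteration I k))     ≤⟨ iteration-operations I k (proj₂ halt k k<T) ⟩
        b * (r * ι (q k))                  ≤⟨ *-monoʳ-≤ (*-nonNeg 0≤r (ι-nonNeg (q k))) b≤b⁺ ⟩
        b⁺ * (r * ι (q k))                 ≈⟨ *-assoc b⁺ r _ ⟨
        b⁺ * r * ι (q k)                   ∎

    -- The hypothesis says that p is at least the integer part of M/L. As p ≥ 1, it follows that M ≤
    -- (p + 1) L ≤ 2 p L, so the work divided by p is of the same order as the parallel time.
    timeOn≤ : ∀ p .{{_ : NonZero p}} → M / L < ι (suc p) → ι (timeOn p (run I T)) ≤ C * (r * L * Λ)
    timeOn≤ p M/L<1+p = *-cancelˡ-≤ 0<p (begin
      ι p * ι (timeOn p (run I T))                                 ≈⟨ ι-* p _ ⟨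
      ι (p ℕ.* timeOn p (run I T))                                 ≤⟨ ι-mono (p*timeOn≤ p (run I T)) ⟩
      ι (p ℕ.* time (run I T) ℕ.+ operations (run I T))
        ≈⟨ trans (ι-+ (p ℕ.* time (run I T)) _) (+-congʳ (ι-* p (time (run I T)))) ⟩
      ι p * ι (time (run I T)) + ι (operations (run I T))
        ≤⟨ +-mono-≤ (*-monoˡ-≤ (<⇒≤ 0<p) time≤) operations≤ ⟩
      ι p * (C₁ * (r * L * Λ)) + C₂ * (r * M * Λ)
        ≤⟨ +-monoʳ-≤ _ (*-monoˡ-≤ 0≤C₂ (*-monoʳ-≤ 0≤Λ (*-monoˡ-≤ 0≤r M≤2pL))) ⟩
      ι p * (C₁ * (r * L * Λ)) + C₂ * (r * ((ι p + ι p) * L) * Λ)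
        ≈⟨ solve 6 (λ p c d r L x → p :* (c :* (r :* L :* x)) :+ d :* (r :* ((p :+ p) :* L) :* x)
             := p :* ((c :+ (d :+ d)) :* (r :* L :* x)))
           refl (ι p) C₁ C₂ r L Λ ⟩
      ι p * (C * (r * L * Λ))                                      ∎)
      where
      p≢0 : p ≢ 0
      p≢0 = ℕ.≢-nonZero⁻¹ p
      0<p : 0# < ι p
      0<p = ι-pos p≢0
      M≤2pL : M ≤ (ι p + ι p) * L
      M≤2pL = begin
        M                    ≈⟨ x/y*y≈x M 0<L ⟨
        M / L * L            ≤⟨ *-monoʳ-≤ (<⇒≤ 0<L) (<⇒≤ M/L<1+p) ⟩
        (1# + ι p) * L       ≤⟨ *-monoʳ-≤ (<⇒≤ 0<L) (+-monoˡ-≤ (ι p) (1≤ι p≢0)) ⟩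
        (ι p + ι p) * L      ∎

    bounds : HaltsAfter I T
      × ι (time (run I T)) ≤ C * (r * L * Λ)
      × ι (operations (run I T)) ≤ C * (r * M * Λ)
      × ((p : ℕ) .{{_ : NonZero p}} → M / L < ι (suc p) →
           ι (timeOn p (run I T)) ≤ C * (r * L * Λ))
    bounds = halt
      , ≤-trans time≤ (*-monoʳ-≤ 0≤rLΛ (x≤x+y (+-nonNeg 0≤C₂ 0≤C₂)))
      , ≤-trans operations≤ (*-monoʳ-≤ (*-nonNeg (*-nonNeg 0≤r 0≤M) 0≤Λ)
          (≤-trans (x≤x+y 0≤C₂) (x≤y+x 0≤C₁)))
      , timeOn≤

  bounds = λ I 2≤m ε≤ε₀ → Bounds.T I 2≤m ε≤ε₀ , Bounds.bounds I 2≤m ε≤ε₀
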